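{- Given a po2DTA $\mathcal A$, one may derive an equivalent $\mathrm{MITL}[\mathsf F_\infty,\mathsf P_\infty]$ formula $\phi_{\mathcal A}$, i.e. such that $\mathcal L(\mathcal A)=\mathcal L(\phi_{\mathcal A})$.
   Context: Timed words: let $\Sigma$ be a finite alphabet. A timed word over $\Sigma$ is a finite nonempty sequence $\rho=(\sigma_1,\tau_1)\cdots(\sigma_n,\tau_n)$ with $\sigma_i\in\Sigma$ and real time stamps $0=\tau_1<\tau_2<\cdots<\tau_n$ (strictly monotonic time). $T\Sigma^*$ is the set of timed words over $\Sigma$. Logic $\mathrm{MITL}[\mathsf F_\infty,\mathsf P_\infty]$: formulas are $\phi::= a\mid \phi\lor\phi\mid\neg\phi\mid \mathsf F_I\phi\mid \mathsf P_I\phi$ with $a\in\Sigma$ and $I$ of the form $[l,\infty)$ or $(l,\infty)$, $l$ a non-negative integer. Semantics: $\rho,i\models a$ iff $\sigma_i=a$; Boolean connectives as usual; $\rho,i\models\mathsf F_I\phi$ iff there is $j>i$ with $\tau_j-\tau_i\in I$ and $\rho,j\models\phi$; $\rho,i\models\mathsf P_I\phi$ iff there is $j<i$ with $\tau_i-\tau_j\in I$ and $\rho,j\models\phi$. $\mathcal L(\phi)=\{\rho\in T\Sigma^*\mid\rho,1\models\phi\}$. po2DTA (partially ordered two-way deterministic timed automata): for a finite set $C$ of clocks, guards are $g::=\top\mid g_1\land g_2\mid x-T\approx c\mid T-x\approx c$ with $x\in C$, $c\in\mathbb N$, $\approx\,\in\{<,\le,>,\ge,=\}$, where $T$ denotes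 the current time; $x-T\approx c$ implicitly includes $x-T\ge0$, and $T-x\approx c$ implicitly includes $T-x\ge 0$. A valuation $\nu$ assigns a non-negative real to each clock; $\nu,\tau\models g$ means $g$ holds under $\nu$ with $T=\tau$. Two guards are disjoint if no $\nu,\tau$ satisfies both. $\nu_{init}$ maps all clocks to $0$. Let $\Sigma'=\Sigma\cup\{\triangleright,\triangleleft\}$. A po2DTA over $\Sigma$ is $M=(Q,\le,\delta,s,t,r,C)$ with $(Q,\le)$ a finite partially ordered set of states, $s$ (initial) the only maximal element, $t$ (accept) and $r$ (reject) the only minimal elements, $Q\setminus\{t,r\}$ partitioned into $Q_L$ (states entered from the left) and $Q_R$ (entered from the right), and a partial function $\delta$ from $(Q_L\cup Q_R)\times\Sigma'\times\{\text{guards}\}$ to $Q\times2^C$ giving the finitely many progress transitions, such that $\delta(q,a,g)=(q',X)$ implies $q'<q$. Determinism: distinct transitions $\delta(q,a,g_1),\delta(q,a,g_2)$ have disjoint guards. End-markers: from every $q\in Q\setminus\{t,r\}$, on $\triangleleft$ a progress transition is always enabled and leads to $Q_R\cup\{t,r\}$; on $\triangleright$ one is always enabled and leads to $Q_L\cup\{t,r\}$. Runs: on $\rho$ the automaton reads $\rho'=(\triangleright,0)(\sigma_1,\tau_1)\cdots(\sigma_n,\tau_n)(\triangleleft,\tau_n)$, positions $0,\dots,n+1$. A configuration is (state, valuation, head position); the run starts in $(s,\nu_{init},1)$. In $(q,\nu,l)$ with $q\notin\{t,r\}$, letter $a$ and time $\tau$ at position $l$: if there is a (unique) $\delta(q,a,g)=(p,X)$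 with $\nu,\tau\models g$, move to state $p$, set all clocks of $X$ to $\tau$, and move the head to $l+1$ if $p\in Q_L$, $l-1$ if $p\in Q_R$, leaving it if $p\in\{t,r\}$; otherwise stay in $q$ with the same valuation and move to $l+1$ if $q\in Q_L$, $l-1$ if $q\in Q_R$. The run stops on reaching $t$ (accepting) or $r$ (rejecting). $\mathcal L(M)$ is the set of $\rho\in T\Sigma^*$ whose run is accepting. -}

module Defs where

open import Algebra.Bundles using (CommutativeRing)
import Algebra.Definitions.RawMonoid as Multiples
open import Data.Bool.Base using (if_then_else_)
open import Data.Fin.Base using (Fin; zero; toℕ; fromℕ; _<_)
open import Data.Fin.Subset using (Subset; _∈_)
open import Data.List.Base using (List)
import Data.List.Membership.Propositional as List
open import Data.Maybe.Base using (Maybe; just)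
open import Data.Nat.Base using (ℕ; suc)
open import Data.Product.Base using (Σ-syntax; ∃; ∃-syntax; _×_; _,_)
open import Data.Sum.Base using (_⊎_)
open import Data.Unit.Base using (⊤)
open import Data.Vec.Base using (lookup)
open import Function.Bundles using (_⇔_)
open import Level using (0ℓ)
open import Relation.Binary.Core using (Rel)
open import Relation.Binary.Construct.Closure.ReflexiveTransitive using (Star)
import Relation.Binary.Construct.StrictToNonStrict as ToNonStrict
open import Relation.Binary.PropositionalEquality using (_≡_; _≢_)
open import Relation.Binary.Structures using (IsPartialOrder; IsStrictTotalOrder)
open import Relation.Nullary.Negation using (¬_)
open import Relation.Unary using (Pred)

-- The real numbers, axiomatised as a complete ordered field. These axioms
-- determine the reals up to isomorphism. Trichotomy (part of IsStrictTotalOrder)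
-- and least upper bounds are the classical axioms; there is no constructive
-- model, and under excluded middle the Cauchy reals are one.
record Reals : Set₁ where
  field
    commutativeRing : CommutativeRing 0ℓ 0ℓ

  open CommutativeRing commutativeRing public
    using (Carrier; _≈_; 0#; 1#; _+_; _*_; _-_; +-rawMonoid)

  infix 4 _<ʳ_

  field
    _<ʳ_               : Rel Carrier 0ℓ
    isStrictTotalOrder : IsStrictTotalOrder _≈_ _<ʳ_

  open ToNonStrict _≈_ _<ʳ_ public using () renaming (_≤_ to _≤ʳ_)

  field
    0≉1       : ¬ (0# ≈ 1#)
    inverse   : ∀ x → ¬ (x ≈ 0#) → ∃[ y ] (x * y ≈ 1#)
    +-monoˡ-< : ∀ {x y} z → x <ʳ y → x + z <ʳ y + z
    *-pos     : ∀ {x y} → 0# <ʳ x → 0# <ʳ y → 0# <ʳ x * y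

  UpperBound : Pred Carrier 0ℓ → Pred Carrier 0ℓ
  UpperBound P u = ∀ x → P x → x ≤ʳ u

  field
    complete : (P : Pred Carrier 0ℓ) → ∃ P → ∃ (UpperBound P) →
               ∃[ u ] (UpperBound P u × (∀ v → UpperBound P v → u ≤ʳ v))

  fromNat : ℕ → Carrier
  fromNat n = n ×ⁿ 1#
    where open Multiples +-rawMonoid using () renaming (_×_ to _×ⁿ_)

-- The alphabet is Fin k. It must be nonempty for formulas to exist at all: letters
-- are the only base case.

data Interval : Set where
  [_,∞⟩ ⟨_,∞⟩ : ℕ → Interval

data MITL (k : ℕ) : Set where
  atom : Fin k → MITL k
  _∨_  : MITL k → MITL k → MITL k
  ¬′_  : MITL k → MITL k
  F P  : Interval → MITL k → MITL k

data Comparison : Set where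
  lt le gt ge eq : Comparison

-- Guards over m clocks: x −T≈[ R ] c is x − T R c, and T− x ≈[ R ] c is T − x R c.
data Guard (m : ℕ) : Set where
  ⊤′          : Guard m
  _∧_         : Guard m → Guard m → Guard m
  _−T≈[_]_    : Fin m → Comparison → ℕ → Guard m
  T−_≈[_]_    : Fin m → Comparison → ℕ → Guard m

data Symbol (k : ℕ) : Set where
  ▷   : Symbol k
  sig : Fin k → Symbol k
  ◁   : Symbol k

-- Positions 0, …, n+1 of a word of length n with end-markers added.
data Position (n : ℕ) : Set where
  ▷  : Position n
  at : Fin n → Position n
  ◁  : Position n

index : ∀ {n} → Position n → ℕ
index     ▷      = 0
index     (at i) = suc (toℕ i)
index {n} ◁      = suc n

Maximal Minimal : {A : Set} → Rel A 0ℓ → Pred A 0ℓ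
Maximal _≤_ q = ∀ p → q ≤ p → p ≡ q
Minimal _≤_ q = ∀ p → p ≤ q → p ≡ q

module _ (ℝ : Reals) where
  open Reals ℝ

  -- Positions are counted from zero, so τ₁ is time zero.
  record TimedWord (k : ℕ) : Set where
    field
      length-1 : ℕ
    length : ℕ
    length = suc length-1
    field
      letter     : Fin length → Fin k
      time       : Fin length → Carrier
      time-first : time zero ≈ 0#
      time-mono  : ∀ {i j} → i < j → time i <ʳ time j

  open TimedWord

  infix 4 _∈ᴵ_

  _∈ᴵ_ : Carrier → Interval → Set
  x ∈ᴵ [ l ,∞⟩ = fromNat l ≤ʳ x
  x ∈ᴵ ⟨ l ,∞⟩ = fromNat l <ʳ x

  Sat : ∀ {k} (ρ : TimedWord k) → Fin (length ρ) → MITL k → Set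
  Sat ρ i (atom a) = letter ρ i ≡ a
  Sat ρ i (φ ∨ ψ)  = Sat ρ i φ ⊎ Sat ρ i ψ
  Sat ρ i (¬′ φ)   = ¬ Sat ρ i φ
  Sat ρ i (F I φ)  = ∃[ j ] (i < j × time ρ j - time ρ i ∈ᴵ I × Sat ρ j φ)
  Sat ρ i (P I φ)  = ∃[ j ] (j < i × time ρ i - time ρ j ∈ᴵ I × Sat ρ j φ)

  Language-MITL : ∀ {k} → MITL k → Pred (TimedWord k) 0ℓ
  Language-MITL φ ρ = Sat ρ zero φ

  -- Valuations are meant to be non-negative. This is required explicitly where
  -- valuations are quantified over; in runs it holds automatically.
  Valuation : ℕ → Set
  Valuation m = Fin m → Carrier

  NonNegative : ∀ {m} → Valuation m → Set
  NonNegative ν = ∀ x → 0# ≤ʳ ν x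

  Compare : Comparison → Carrier → Carrier → Set
  Compare lt x y = x <ʳ y
  Compare le x y = x ≤ʳ y
  Compare gt x y = y <ʳ x
  Compare ge x y = y ≤ʳ x
  Compare eq x y = x ≈ y

  Holds : ∀ {m} → Valuation m → Carrier → Guard m → Set
  Holds ν τ ⊤′              = ⊤
  Holds ν τ (g ∧ h)         = Holds ν τ g × Holds ν τ h
  Holds ν τ (x −T≈[ R ] c)  = 0# ≤ʳ ν x - τ × Compare R (ν x - τ) (fromNat c)
  Holds ν τ (T− x ≈[ R ] c) = 0# ≤ʳ τ - ν x × Compare R (τ - ν x) (fromNat c)

  Disjoint : ∀ {m} → Guard m → Guard m → Set
  Disjoint g h = ∀ ν τ → NonNegative ν → 0# ≤ʳ τ → ¬ (Holds ν τ g × Holds ν τ h)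

  record Po2DTA (k : ℕ) : Set₁ where
    field
      states : ℕ
      clocks : ℕ

    State : Set
    State = Fin states

    field
      _≤_            : Rel State 0ℓ
      isPartialOrder : IsPartialOrder _≡_ _≤_

    field
      s t r   : State
      maximal : ∀ q → Maximal _≤_ q ⇔ q ≡ s
      minimal : ∀ q → Minimal _≤_ q ⇔ (q ≡ t ⊎ q ≡ r)
      t≢r     : t ≢ r

    Halted : Pred State 0ℓ
    Halted q = q ≡ t ⊎ q ≡ r

    field
      Q-L Q-R  : Subset states
      covering : ∀ q → (q ∈ Q-L ⊎ q ∈ Q-R) ⇔ (¬ Halted q)
      disjoint : ∀ q → ¬ (q ∈ Q-L × q ∈ Q-R)

      -- A partial function with finite domain. It is undefined at t and r
      -- because of progress and the minimality of those states.
      δ         : State → Symbol k → Guard clocks → Maybe (State × Subset clocks)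
      domain    : List (State × Symbol k × Guard clocks)
      in-domain : ∀ {q a g q′ X} → δ q a g ≡ just (q′ , X) → (q , a , g) List.∈ domain

      progress      : ∀ {q a g q′ X} → δ q a g ≡ just (q′ , X) → q′ ≤ q × q′ ≢ q
      deterministic : ∀ {q a g₁ g₂ p₁ p₂ X₁ X₂} →
                      δ q a g₁ ≡ just (p₁ , X₁) → δ q a g₂ ≡ just (p₂ , X₂) →
                      g₁ ≢ g₂ → Disjoint g₁ g₂

      right-end : ∀ q → ¬ Halted q → ∀ ν τ → NonNegative ν → 0# ≤ʳ τ →
                  ∃[ g ] ∃[ q′ ] ∃[ X ]
                    (δ q ◁ g ≡ just (q′ , X) × Holds ν τ g × (q′ ∈ Q-R ⊎ Halted q′))
      left-end  : ∀ q → ¬ Halted q → ∀ ν τ → NonNegative ν → 0# ≤ʳ τ →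
                  ∃[ g ] ∃[ q′ ] ∃[ X ]
                    (δ q ▷ g ≡ just (q′ , X) × Holds ν τ g × (q′ ∈ Q-L ⊎ Halted q′))

  reset : ∀ {m} → Valuation m → Subset m → Carrier → Valuation m
  reset ν X τ x = if lookup X x then τ else ν x

  symbolAt : ∀ {k} (ρ : TimedWord k) → Position (length ρ) → Symbol k
  symbolAt ρ ▷      = ▷
  symbolAt ρ (at i) = sig (letter ρ i)
  symbolAt ρ ◁      = ◁

  timeAt : ∀ {k} (ρ : TimedWord k) → Position (length ρ) → Carrier
  timeAt ρ ▷      = 0#
  timeAt ρ (at i) = time ρ i
  timeAt ρ ◁      = time ρ (fromℕ (length-1 ρ))

  module Run {k} (A : Po2DTA k) (ρ : TimedWord k) where
    open Po2DTA A

    Configuration : Set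
    Configuration = State × Valuation clocks × Position (length ρ)

    initial : Configuration
    initial = s , (λ _ → 0#) , at zero

    -- Move p l l′: a head at l moves to l′ when the automaton is (now) in state p.
    data Move (p : State) (l l′ : Position (length ρ)) : Set where
      rightward : p ∈ Q-L → index l′ ≡ suc (index l) → Move p l l′
      leftward  : p ∈ Q-R → index l ≡ suc (index l′) → Move p l l′
      remain    : Halted p → l′ ≡ l → Move p l l′

    infix 4 _⟶_

    data _⟶_ : Rel Configuration 0ℓ where
      transition : ∀ {q ν l g p X l′} → ¬ Halted q →
                   δ q (symbolAt ρ l) g ≡ just (p , X) → Holds ν (timeAt ρ l) g →
                   Move p l l′ →
                   (q , ν , l) ⟶ (p , reset ν X (timeAt ρ l) , l′)
      stay       : ∀ {q ν l l′} → ¬ Halted q →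
                   (∀ {g p X} → δ q (symbolAt ρ l) g ≡ just (p , X) →
                    ¬ Holds ν (timeAt ρ l) g) →
                   Move q l l′ →
                   (q , ν , l) ⟶ (q , ν , l′)

    Accepting : Set
    Accepting = ∃[ ν ] ∃[ l ] Star _⟶_ initial (t , ν , l)

  Language-Po2DTA : ∀ {k} → Po2DTA k → Pred (TimedWord k) 0ℓ
  Language-Po2DTA A ρ = Run.Accepting A ρ

{-# OPTIONS --safe #-}
module Submission where

-- Since δ strictly descends in the partial order on states, the formula is built by
-- well-founded recursion on the state. Throughout the recursion each clock is
-- represented by a formula true at exactly one position, whose time stamp is the value
-- of the clock, and the part of the word still ahead of the head is represented by
-- another formula. Relative to a uniquely marked position every guard is expressible
-- with unbounded intervals: T − x > c is P_(c,∞) of the marker, and upper bounds are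
-- negated lower bounds. A state sweeps in one direction until the first position that
-- enables a transition; "first" is expressible with P or F, so the position where a
-- given transition fires is again uniquely marked, and this marker represents the
-- clocks that the transition resets. Acceptance from a state is the disjunction, over
-- its transitions, of "the transition fires somewhere, and acceptance follows from its
-- target".

open import Defs
open import Algebra.Bundles using (CommutativeRing)
import Algebra.Properties.AbelianGroup as AbelianGroupProperties
import Algebra.Properties.Ring as RingProperties
open import Axiom.UniquenessOfIdentityProofs.WithK using (uip)
open import Data.Bool.Base using (true; false; if_then_else_)
open import Data.Empty using (⊥-elim)
open import Data.Fin.Base using (Fin; zero; toℕ; fromℕ; fromℕ<; _<_)
import Data.Fin.Properties as Fin
open import Data.Fin.Induction using (po-wellFounded)
open import Data.Fin.Subset using (Subset; _∈_)
open import Data.List.Base using (List; []; _∷_; map; foldr; mapMaybe)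
import Data.List.Membership.Propositional as List
open import Data.List.Relation.Unary.Any using (here; there)
open import Data.Maybe.Base using (Maybe; just; nothing; maybe′)
import Data.Nat.Base as ℕ
open import Data.Nat.Base using (ℕ; zero; suc; NonZero; z≤n; s≤s)
import Data.Nat.Properties as ℕ
open import Data.Product.Base using (Σ-syntax; ∃-syntax; _×_; _,_; proj₂)
open import Data.Sum.Base using (_⊎_; inj₁; inj₂; [_,_]′)
open import Data.Unit.Base using (tt)
open import Data.Vec.Base using (lookup)
open import Function.Base using (_∘_; id)
open import Function.Bundles using (_⇔_; mk⇔; Equivalence)
open import Induction.WellFounded using (Acc; acc)
open import Relation.Binary.Construct.Closure.ReflexiveTransitive using (Star; ε; _◅_; _◅◅_)
import Relation.Binary.Construct.NonStrictToStrict as ToStrict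
import Relation.Binary.Construct.StrictToNonStrict as ToNonStrict
open import Relation.Binary.Definitions using (Tri; tri<; tri≈; tri>)
open import Relation.Binary.PropositionalEquality using (_≡_; _≢_; refl; sym; trans; cong; subst)
open import Relation.Binary.Structures using (IsStrictTotalOrder)
open import Relation.Nullary.Decidable.Core using (Dec; yes; no; _×-dec_; _⊎-dec_; ¬?; decidable-stable)
open import Relation.Nullary.Negation using (¬_; contradiction)
open import Relation.Unary using (_≐_)

open Equivalence using (to; from)

∈-mapMaybe⁺ : ∀ {A B : Set} (f : A → Maybe B) {x y xs} →
              x List.∈ xs → f x ≡ just y → y List.∈ mapMaybe f xs
∈-mapMaybe⁺ f {xs = x ∷ _} (here refl) e rewrite e = here refl
∈-mapMaybe⁺ f {xs = x ∷ _} (there p) e with f x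
... | just _  = there (∈-mapMaybe⁺ f p e)
... | nothing = ∈-mapMaybe⁺ f p e

data Direction : Set where
  right left : Direction

flip : Direction → Direction
flip right = left
flip left  = right

-- Order and sign facts in an ordered field.

module OrderedField (ℝ : Reals) where
  open Reals ℝ public
  open CommutativeRing commutativeRing public
    using (-_; ring; +-abelianGroup; +-cong; -‿cong; +-identityˡ; +-identityʳ; -‿inverseʳ)
    renaming (refl to ≈-refl; sym to ≈-sym; trans to ≈-trans)
  open IsStrictTotalOrder isStrictTotalOrder public
    using (compare; irrefl; asym; <-respˡ-≈; <-respʳ-≈)
    renaming (trans to <-trans; _<?_ to _<ʳ?_)
  open RingProperties ring using (-1*x≈-x)
  open AbelianGroupProperties +-abelianGroup using (⁻¹-involutive)

  _≤ʳ?_ : ∀ x y → Dec (x ≤ʳ y)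
  _≤ʳ?_ = ToNonStrict.decidable′ _≈_ _<ʳ_ compare

  ≤-respʳ : ∀ {x y z} → y ≈ z → x ≤ʳ y → x ≤ʳ z
  ≤-respʳ = ToNonStrict.≤-respʳ-≈ _≈_ _<ʳ_ ≈-trans <-respʳ-≈

  ≤-respˡ : ∀ {x y z} → y ≈ z → y ≤ʳ x → z ≤ʳ x
  ≤-respˡ = ToNonStrict.≤-respˡ-≈ _≈_ _<ʳ_ ≈-sym ≈-trans <-respˡ-≈

  ≤-<-trans : ∀ {x y z} → x ≤ʳ y → y <ʳ z → x <ʳ z
  ≤-<-trans = ToNonStrict.≤-<-trans _≈_ _<ʳ_ ≈-sym <-trans <-respˡ-≈

  <-≤-trans : ∀ {x y z} → x <ʳ y → y ≤ʳ z → x <ʳ z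
  <-≤-trans = ToNonStrict.<-≤-trans _≈_ _<ʳ_ <-trans <-respʳ-≈

  ≤-antisym : ∀ {x y} → x ≤ʳ y → y ≤ʳ x → x ≈ y
  ≤-antisym (inj₂ x≈y) _          = x≈y
  ≤-antisym (inj₁ _)   (inj₂ y≈x) = ≈-sym y≈x
  ≤-antisym (inj₁ x<y) (inj₁ y<x) = contradiction y<x (asym x<y)

  ≮⇒≥ : ∀ {x y} → ¬ (x <ʳ y) → y ≤ʳ x
  ≮⇒≥ {x} {y} x≮y with compare x y
  ... | tri< x<y _ _ = contradiction x<y x≮y
  ... | tri≈ _ x≈y _ = inj₂ (≈-sym x≈y)
  ... | tri> _ _ y<x = inj₁ y<x

  ≰⇒> : ∀ {x y} → ¬ (x ≤ʳ y) → y <ʳ x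
  ≰⇒> {x} {y} x≰y with compare x y
  ... | tri< x<y _ _ = contradiction (inj₁ x<y) x≰y
  ... | tri≈ _ x≈y _ = contradiction (inj₂ x≈y) x≰y
  ... | tri> _ _ y<x = y<x

  <⇒≱ : ∀ {x y} → x <ʳ y → ¬ (y ≤ʳ x)
  <⇒≱ x<y y≤x = irrefl ≈-refl (<-≤-trans x<y y≤x)

  x<y⇒0<y-x : ∀ {x y} → x <ʳ y → 0# <ʳ y - x
  x<y⇒0<y-x {x} x<y = <-respˡ-≈ (-‿inverseʳ x) (+-monoˡ-< (- x) x<y)

  x<y⇒x-y<0 : ∀ {x y} → x <ʳ y → x - y <ʳ 0#
  x<y⇒x-y<0 {y = y} x<y = <-respʳ-≈ (-‿inverseʳ y) (+-monoˡ-< (- y) x<y)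

  x≈y⇒x-y≈0 : ∀ {x y} → x ≈ y → x - y ≈ 0#
  x≈y⇒x-y≈0 {y = y} x≈y = ≈-trans (+-cong x≈y ≈-refl) (-‿inverseʳ y)

  -- If 1 < 0 then 0 < -1, so 0 < (-1)(-1) = 1.
  0<1 : 0# <ʳ 1#
  0<1 with compare 0# 1#
  ... | tri< 0<1 _ _ = 0<1
  ... | tri≈ _ 0≈1 _ = contradiction 0≈1 0≉1
  ... | tri> _ _ 1<0 = <-respʳ-≈ (≈-trans (-1*x≈-x (- 1#)) (⁻¹-involutive 1#)) (*-pos 0<-1 0<-1)
    where
    0<-1 : 0# <ʳ - 1#
    0<-1 = <-respʳ-≈ (+-identityˡ (- 1#)) (x<y⇒0<y-x 1<0)

  0<fromNat-suc : ∀ c → 0# <ʳ fromNat (suc c)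
  0<fromNat-suc zero    = <-respʳ-≈ (≈-sym (+-identityʳ 1#)) 0<1
  0<fromNat-suc (suc c) =
    <-trans (0<fromNat-suc c) (<-respˡ-≈ (+-identityˡ _) (+-monoˡ-< (fromNat (suc c)) 0<1))

  0≤fromNat : ∀ c → 0# ≤ʳ fromNat c
  0≤fromNat zero    = inj₂ ≈-refl
  0≤fromNat (suc c) = inj₁ (0<fromNat-suc c)

  infix 4 _∈?ᴵ_

  _∈?ᴵ_ : ∀ x I → Dec (_∈ᴵ_ ℝ x I)
  x ∈?ᴵ [ l ,∞⟩ = fromNat l ≤ʳ? x
  x ∈?ᴵ ⟨ l ,∞⟩ = fromNat l <ʳ? x

  ∈ᴵ-resp-≈ : ∀ I {x y} → x ≈ y → _∈ᴵ_ ℝ x I → _∈ᴵ_ ℝ y I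
  ∈ᴵ-resp-≈ [ _ ,∞⟩ = ≤-respʳ
  ∈ᴵ-resp-≈ ⟨ _ ,∞⟩ = <-respʳ-≈

  Compare-respˡ-≈ : ∀ R {x y z} → x ≈ y → Compare ℝ R x z → Compare ℝ R y z
  Compare-respˡ-≈ lt = <-respˡ-≈
  Compare-respˡ-≈ le = ≤-respˡ
  Compare-respˡ-≈ gt = <-respʳ-≈
  Compare-respˡ-≈ ge = ≤-respʳ
  Compare-respˡ-≈ eq x≈y = ≈-trans (≈-sym x≈y)

  Holds-resp-≈ : ∀ {m} {ν : Valuation ℝ m} {τ τ′} g → τ ≈ τ′ → Holds ℝ ν τ g → Holds ℝ ν τ′ g
  Holds-resp-≈ ⊤′ τ≈τ′ _ = tt
  Holds-resp-≈ (g ∧ h) τ≈τ′ (hg , hh) = Holds-resp-≈ g τ≈τ′ hg , Holds-resp-≈ h τ≈τ′ hh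
  Holds-resp-≈ (x −T≈[ R ] c) τ≈τ′ (0≤ , cmp) = ≤-respʳ e 0≤ , Compare-respˡ-≈ R e cmp
    where e = +-cong ≈-refl (-‿cong τ≈τ′)
  Holds-resp-≈ (T− x ≈[ R ] c) τ≈τ′ (0≤ , cmp) = ≤-respʳ e 0≤ , Compare-respˡ-≈ R e cmp
    where e = +-cong τ≈τ′ ≈-refl

  -- With a clock value as first argument and the current time as second, `right` gives the quantity
  -- T - x of a guard and `left` gives x - T, so one argument covers both.
  elapsed : Direction → Carrier → Carrier → Carrier
  elapsed right u v = v - u
  elapsed left  u v = u - v

  elapsed-congˡ : ∀ d {u u′ v} → u ≈ u′ → elapsed d u v ≈ elapsed d u′ v
  elapsed-congˡ right u≈u′ = +-cong ≈-refl (-‿cong u≈u′)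
  elapsed-congˡ left  u≈u′ = +-cong u≈u′ ≈-refl

-- Derived connectives and formulas for guards.

module Syntax {k} (a₀ : Fin k) where

  -- The grammar has no constants, so truth is built from some letter.
  ⊤ᶠ ⊥ᶠ : MITL k
  ⊤ᶠ = atom a₀ ∨ (¬′ atom a₀)
  ⊥ᶠ = ¬′ ⊤ᶠ

  infixr 6 _∧ᶠ_

  _∧ᶠ_ : MITL k → MITL k → MITL k
  φ ∧ᶠ ψ = ¬′ ((¬′ φ) ∨ (¬′ ψ))

  ⋁ : List (MITL k) → MITL k
  ⋁ = foldr _∨_ ⊥ᶠ

  -- Behind a head that moves to the right lies the past, behind one that moves to
  -- the left lies the future.
  since : Direction → Interval → MITL k → MITL k
  since right = P
  since left  = F

  earlier : Direction → MITL k → MITL k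
  earlier d = since d [ 0 ,∞⟩

  sometime : MITL k → MITL k
  sometime φ = φ ∨ (earlier right φ ∨ earlier left φ)

  final : Direction → MITL k
  final d = ¬′ earlier (flip d) ⊤ᶠ

  -- `since` is strict and would miss the marked position itself, where the elapsed time is zero.
  -- Hence the bound 0 becomes `⊤ᶠ`; non-negativity is checked separately in `guardᶠ`.
  atLeast : Direction → ℕ → MITL k → MITL k
  atLeast d zero    ψ = ⊤ᶠ
  atLeast d (suc c) ψ = since d [ suc c ,∞⟩ ψ

  compared : Direction → Comparison → ℕ → MITL k → MITL k
  compared d lt c ψ = ¬′ atLeast d c ψ
  compared d le c ψ = ¬′ since d ⟨ c ,∞⟩ ψ
  compared d gt c ψ = since d ⟨ c ,∞⟩ ψ
  compared d ge c ψ = atLeast d c ψ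
  compared d eq c ψ = atLeast d c ψ ∧ᶠ ¬′ since d ⟨ c ,∞⟩ ψ

  -- A clock is represented by a formula that marks a unique position whose time
  -- stamp is the value of the clock.
  Clocks : ℕ → Set
  Clocks m = Fin m → MITL k

  -- The first conjunct is the implicit non-negativity condition: x - T needs the marker at or after
  -- the current position, T - x at or before it. The upper bounds in `compared` are negations and
  -- could otherwise hold on the wrong side of the marker.
  guardᶠ : ∀ {m} → Clocks m → Guard m → MITL k
  guardᶠ ψ ⊤′              = ⊤ᶠ
  guardᶠ ψ (g ∧ h)         = guardᶠ ψ g ∧ᶠ guardᶠ ψ h
  guardᶠ ψ (x −T≈[ R ] c)  = (ψ x ∨ earlier left (ψ x)) ∧ᶠ compared left R c (ψ x)
  guardᶠ ψ (T− x ≈[ R ] c) = (ψ x ∨ earlier right (ψ x)) ∧ᶠ compared right R c (ψ x)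

-- Semantics of the derived connectives.

module Semantics (ℝ : Reals) {k} (a₀ : Fin k) (ρ : TimedWord ℝ k) where
  open OrderedField ℝ
  open Syntax a₀
  open TimedWord ρ

  infix 4 _⊨_ _⊨?_

  _⊨_ : Fin length → MITL k → Set
  i ⊨ φ = Sat ℝ ρ i φ

  -- A word has finitely many positions and the order of the reals is decidable. Truth and
  -- conjunction, defined classically, acquire their meaning from this.
  _⊨?_ : ∀ i φ → Dec (i ⊨ φ)
  i ⊨? atom a  = letter i Fin.≟ a
  i ⊨? (φ ∨ ψ) = (i ⊨? φ) ⊎-dec (i ⊨? ψ)
  i ⊨? (¬′ φ)  = ¬? (i ⊨? φ)
  i ⊨? F I φ   = Fin.any? λ j → (i Fin.<? j) ×-dec (time j - time i ∈?ᴵ I) ×-dec (j ⊨? φ)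
  i ⊨? P I φ   = Fin.any? λ j → (j Fin.<? i) ×-dec (time i - time j ∈?ᴵ I) ×-dec (j ⊨? φ)

  ⊨-⊤ : ∀ {i} → i ⊨ ⊤ᶠ
  ⊨-⊤ {i} with i ⊨? atom a₀
  ... | yes p = inj₁ p
  ... | no ¬p = inj₂ ¬p

  ⊭-⊥ : ∀ {i} → ¬ (i ⊨ ⊥ᶠ)
  ⊭-⊥ {i} ¬⊤ = ¬⊤ (⊨-⊤ {i})

  ⊨-∧ : ∀ {i φ ψ} → i ⊨ φ ∧ᶠ ψ ⇔ (i ⊨ φ × i ⊨ ψ)
  ⊨-∧ {i} {φ} {ψ} = mk⇔
    (λ p → decidable-stable (i ⊨? φ) (p ∘ inj₁) , decidable-stable (i ⊨? ψ) (p ∘ inj₂))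
    (λ (p , q) → [ (λ ¬p → ¬p p) , (λ ¬q → ¬q q) ]′)

  ⊨-⋁⁺ : ∀ {A : Set} {i f} {x : A} {xs} → x List.∈ xs → i ⊨ f x → i ⊨ ⋁ (map f xs)
  ⊨-⋁⁺ (here refl) p = inj₁ p
  ⊨-⋁⁺ (there x∈xs) p = inj₂ (⊨-⋁⁺ x∈xs p)

  ⊨-⋁⁻ : ∀ {A : Set} {i f} (xs : List A) → i ⊨ ⋁ (map f xs) → ∃[ x ] i ⊨ f x
  ⊨-⋁⁻ {i = i} [] p = ⊥-elim (⊭-⊥ {i} p)
  ⊨-⋁⁻ (x ∷ xs) (inj₁ p) = x , p
  ⊨-⋁⁻ (x ∷ xs) (inj₂ p) = ⊨-⋁⁻ xs p

  Before : Direction → Fin length → Fin length → Set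
  Before right i j = i < j
  Before left  i j = j < i

  Before-flip : ∀ d {i j} → Before d i j → Before (flip d) j i
  Before-flip right = id
  Before-flip left  = id

  Before-unflip : ∀ d {i j} → Before (flip d) i j → Before d j i
  Before-unflip right = id
  Before-unflip left  = id

  Before-cmp : ∀ d i j → Tri (Before d i j) (i ≡ j) (Before d j i)
  Before-cmp right i j = Fin.<-cmp i j
  Before-cmp left i j with Fin.<-cmp i j
  ... | tri< a b c = tri> c b a
  ... | tri≈ a b c = tri≈ c b a
  ... | tri> a b c = tri< c b a

  elapsed-pos : ∀ d {i j} → Before d i j → 0# <ʳ elapsed d (time i) (time j)
  elapsed-pos right i<j = x<y⇒0<y-x (time-mono i<j)
  elapsed-pos left  j<i = x<y⇒0<y-x (time-mono j<i)

  elapsed-neg : ∀ d {i j} → Before d j i → elapsed d (time i) (time j) <ʳ 0#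
  elapsed-neg right j<i = x<y⇒x-y<0 (time-mono j<i)
  elapsed-neg left  i<j = x<y⇒x-y<0 (time-mono i<j)

  elapsed-self : ∀ d i → elapsed d (time i) (time i) ≈ 0#
  elapsed-self right i = x≈y⇒x-y≈0 ≈-refl
  elapsed-self left  i = x≈y⇒x-y≈0 ≈-refl

  ⊨-since : ∀ d {I φ j} →
            j ⊨ since d I φ ⇔ (∃[ i ] (Before d i j × _∈ᴵ_ ℝ (elapsed d (time i) (time j)) I × i ⊨ φ))
  ⊨-since right = mk⇔ id id
  ⊨-since left  = mk⇔ id id

  -- Time is strictly monotonic, so the interval from 0 restricts nothing beyond the order of
  -- positions.
  ⊨-earlier : ∀ d {φ j} → j ⊨ earlier d φ ⇔ (∃[ i ] (Before d i j × i ⊨ φ))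
  ⊨-earlier d {φ} = mk⇔
    (λ p → let i , b , _ , q = to (⊨-since d {φ = φ}) p in i , b , q)
    (λ (i , b , q) → from (⊨-since d {φ = φ}) (i , b , inj₁ (elapsed-pos d b) , q))

  ⊨-sometime : ∀ {φ i} → i ⊨ sometime φ ⇔ (∃[ j ] j ⊨ φ)
  ⊨-sometime {φ} {i} = mk⇔ f g
    where
    f : i ⊨ sometime φ → ∃[ j ] j ⊨ φ
    f (inj₁ p) = i , p
    f (inj₂ (inj₁ p)) = let j , _ , q = to (⊨-earlier right {φ}) p in j , q
    f (inj₂ (inj₂ p)) = let j , _ , q = to (⊨-earlier left {φ}) p in j , q
    g : ∃[ j ] j ⊨ φ → i ⊨ sometime φ
    g (j , p) with Fin.<-cmp i j
    ... | tri< i<j _ _ = inj₂ (inj₂ (from (⊨-earlier left {φ}) (j , i<j , p)))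
    ... | tri≈ _ refl _ = inj₁ p
    ... | tri> _ _ j<i = inj₂ (inj₁ (from (⊨-earlier right {φ}) (j , j<i , p)))

  -- Uniquely marked positions and correctness of guards.

  Marks : MITL k → Fin length → Set
  Marks φ i = ∀ j → j ⊨ φ ⇔ j ≡ i

  endpoint : Direction → Fin length
  endpoint right = fromℕ length-1
  endpoint left  = zero

  endpoint-last : ∀ d i → ¬ Before d (endpoint d) i
  endpoint-last right i p = ℕ.<⇒≱ p (Fin.≤fromℕ i)
  endpoint-last left  i ()

  final-marks : ∀ d → Marks (final d) (endpoint d)
  final-marks d j = mk⇔ f g
    where
    f : j ⊨ final d → j ≡ endpoint d
    f p with Before-cmp d j (endpoint d)
    ... | tri< b _ _ = contradiction (from (⊨-earlier (flip d) {φ = ⊤ᶠ}) (endpoint d , Before-flip d b , ⊨-⊤)) p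
    ... | tri≈ _ e _ = e
    ... | tri> _ _ b = contradiction b (endpoint-last d j)
    g : j ≡ endpoint d → j ⊨ final d
    g refl p = let i , b , _ = to (⊨-earlier (flip d) {φ = ⊤ᶠ}) p in endpoint-last d i (Before-unflip d b)

  -- The clock value `u` is tied to `time i` only up to `≈`, because an initial clock, or one reset
  -- at ▷, has the value `0#`.
  module _ {ψ : MITL k} {i : Fin length} {u : Carrier} (ψ-marks : Marks ψ i) (u≈ : u ≈ time i) where

    since-correct : ∀ d I {j} →
                    j ⊨ since d I ψ ⇔ (Before d i j × _∈ᴵ_ ℝ (elapsed d u (time j)) I)
    since-correct d I {j} = mk⇔ f g
      where
      f : j ⊨ since d I ψ → Before d i j × _∈ᴵ_ ℝ (elapsed d u (time j)) I
      f p with to (⊨-since d {φ = ψ}) p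
      ... | i′ , b , e , q with to (ψ-marks i′) q
      ... | refl = b , ∈ᴵ-resp-≈ I (elapsed-congˡ d (≈-sym u≈)) e
      g : Before d i j × _∈ᴵ_ ℝ (elapsed d u (time j)) I → j ⊨ since d I ψ
      g (b , e) = from (⊨-since d {φ = ψ})
        (i , b , ∈ᴵ-resp-≈ I (elapsed-congˡ d u≈) e , from (ψ-marks i) refl)

    -- The sign of the elapsed time decides the order of the positions, so a bound that forces it to
    -- be positive already yields the order that `since` demands.
    0<elapsed⇒Before : ∀ d {j} → 0# <ʳ elapsed d u (time j) → Before d i j
    0<elapsed⇒Before d {j} 0< with Before-cmp d i j
    ... | tri< b _ _ = b
    ... | tri≈ _ refl _ =
      ⊥-elim (irrefl (≈-sym (≈-trans (elapsed-congˡ d u≈) (elapsed-self d i))) 0<)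
    ... | tri> _ _ b =
      ⊥-elim (asym (<-respʳ-≈ (elapsed-congˡ d u≈) 0<) (elapsed-neg d b))

    once-correct : ∀ d {j} → j ⊨ ψ ∨ earlier d ψ ⇔ 0# ≤ʳ elapsed d u (time j)
    once-correct d {j} = mk⇔ f g
      where
      f : j ⊨ ψ ∨ earlier d ψ → 0# ≤ʳ elapsed d u (time j)
      f (inj₁ p) with to (ψ-marks j) p
      ... | refl = inj₂ (≈-sym (≈-trans (elapsed-congˡ d u≈) (elapsed-self d i)))
      f (inj₂ p) = proj₂ (to (since-correct d [ 0 ,∞⟩) p)
      g : 0# ≤ʳ elapsed d u (time j) → j ⊨ ψ ∨ earlier d ψ
      g 0≤ with Before-cmp d i j
      ... | tri< b _ _ = inj₂ (from (since-correct d [ 0 ,∞⟩) (b , 0≤))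
      ... | tri≈ _ refl _ = inj₁ (from (ψ-marks i) refl)
      ... | tri> _ _ b = ⊥-elim (<⇒≱ (elapsed-neg d b) (≤-respʳ (elapsed-congˡ d u≈) 0≤))

    beyond-correct : ∀ d c {j} → j ⊨ since d ⟨ c ,∞⟩ ψ ⇔ fromNat c <ʳ elapsed d u (time j)
    beyond-correct d c = mk⇔
      (proj₂ ∘ to (since-correct d ⟨ c ,∞⟩))
      (λ c< → from (since-correct d ⟨ c ,∞⟩) (0<elapsed⇒Before d (≤-<-trans (0≤fromNat c) c<) , c<))

    atLeast-correct : ∀ d c {j} → 0# ≤ʳ elapsed d u (time j) →
                      j ⊨ atLeast d c ψ ⇔ fromNat c ≤ʳ elapsed d u (time j)
    atLeast-correct d zero    0≤ = mk⇔ (λ _ → 0≤) (λ _ → ⊨-⊤)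
    atLeast-correct d (suc c) 0≤ = mk⇔
      (proj₂ ∘ to (since-correct d [ suc c ,∞⟩))
      (λ c≤ → from (since-correct d [ suc c ,∞⟩)
                (0<elapsed⇒Before d (<-≤-trans (0<fromNat-suc c) c≤) , c≤))

    compared-correct : ∀ d R c {j} → 0# ≤ʳ elapsed d u (time j) →
                       j ⊨ compared d R c ψ ⇔ Compare ℝ R (elapsed d u (time j)) (fromNat c)
    compared-correct d lt c 0≤ = mk⇔
      (λ p → ≰⇒> (p ∘ from (atLeast-correct d c 0≤)))
      (λ e p → <⇒≱ e (to (atLeast-correct d c 0≤) p))
    compared-correct d le c 0≤ = mk⇔
      (λ p → ≮⇒≥ (p ∘ from (beyond-correct d c)))
      (λ e p → <⇒≱ (to (beyond-correct d c) p) e)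
    compared-correct d gt c 0≤ = beyond-correct d c
    compared-correct d ge c 0≤ = atLeast-correct d c 0≤
    compared-correct d eq c {j} 0≤ = mk⇔ f g
      where
      f : j ⊨ compared d eq c ψ → elapsed d u (time j) ≈ fromNat c
      f p with to (⊨-∧ {φ = atLeast d c ψ} {¬′ since d ⟨ c ,∞⟩ ψ}) p
      ... | q , ¬q = ≤-antisym (≮⇒≥ (¬q ∘ from (beyond-correct d c))) (to (atLeast-correct d c 0≤) q)
      g : elapsed d u (time j) ≈ fromNat c → j ⊨ compared d eq c ψ
      g e = from (⊨-∧ {φ = atLeast d c ψ} {¬′ since d ⟨ c ,∞⟩ ψ})
        ( from (atLeast-correct d c 0≤) (inj₂ (≈-sym e))
        , λ q → irrefl (≈-sym e) (to (beyond-correct d c) q))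

    constraint-correct : ∀ d R c {j} →
      j ⊨ (ψ ∨ earlier d ψ) ∧ᶠ compared d R c ψ ⇔
      (0# ≤ʳ elapsed d u (time j) × Compare ℝ R (elapsed d u (time j)) (fromNat c))
    constraint-correct d R c {j} = mk⇔ f g
      where
      ∧-correct = ⊨-∧ {i = j} {φ = ψ ∨ earlier d ψ} {compared d R c ψ}
      f : _ → _
      f p with to ∧-correct p
      ... | q , q′ = let 0≤ = to (once-correct d) q in 0≤ , to (compared-correct d R c 0≤) q′
      g : _ → _
      g (0≤ , e) = from ∧-correct (from (once-correct d) 0≤ , from (compared-correct d R c 0≤) e)

  Represents : ∀ {m} → Clocks m → Valuation ℝ m → Set
  Represents ψ ν = ∀ x → ∃[ i ] (ν x ≈ time i × Marks (ψ x) i)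

  guard-correct : ∀ {m} {ψ : Clocks m} {ν} → Represents ψ ν → ∀ g {j} →
                  j ⊨ guardᶠ ψ g ⇔ Holds ℝ ν (time j) g
  guard-correct rep ⊤′ = mk⇔ (λ _ → tt) (λ _ → ⊨-⊤)
  guard-correct {ψ = ψ} rep (g ∧ h) = mk⇔
    (λ p → let q , q′ = to (⊨-∧ {φ = guardᶠ ψ g} {guardᶠ ψ h}) p
           in to (guard-correct rep g) q , to (guard-correct rep h) q′)
    (λ (q , q′) → from (⊨-∧ {φ = guardᶠ ψ g} {guardᶠ ψ h})
                    (from (guard-correct rep g) q , from (guard-correct rep h) q′))
  guard-correct rep (x −T≈[ R ] c) =
    let _ , ν≈ , marks = rep x in constraint-correct marks ν≈ left R c
  guard-correct rep (T− x ≈[ R ] c) =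
    let _ , ν≈ , marks = rep x in constraint-correct marks ν≈ right R c

  -- Head positions ordered along a sweep.

  NotStart : Direction → Position length → Set
  NotStart right l = l ≢ ▷
  NotStart left  l = l ≢ ◁

  Next : Direction → Position length → Position length → Set
  Next right l l′ = index l′ ≡ suc (index l)
  Next left  l l′ = index l ≡ suc (index l′)

  infix 4 _⊏[_]_ _⊑[_]_

  _⊏[_]_ _⊑[_]_ : Position length → Direction → Position length → Set
  l ⊏[ right ] l′ = index l ℕ.< index l′
  l ⊏[ left  ] l′ = index l′ ℕ.< index l
  l ⊑[ right ] l′ = index l ℕ.≤ index l′
  l ⊑[ left  ] l′ = index l′ ℕ.≤ index l

  Gap : Direction → ℕ → Position length → Position length → Set
  Gap right g l l′ = g ℕ.+ index l ≡ index l′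
  Gap left  g l l′ = g ℕ.+ index l′ ≡ index l

  index-bounded : (l : Position length) → index l ℕ.≤ suc length
  index-bounded ▷      = z≤n
  index-bounded (at i) = s≤s (ℕ.<⇒≤ (Fin.toℕ<n i))
  index-bounded ◁      = ℕ.≤-refl

  index-injective : {l l′ : Position length} → index l ≡ index l′ → l ≡ l′
  index-injective {▷}    {▷}    _ = refl
  index-injective {at i} {at j} e = cong at (Fin.toℕ-injective (ℕ.suc-injective e))
  index-injective {◁}    {◁}    _ = refl
  index-injective {at i} {◁}    e = contradiction (ℕ.suc-injective e) (ℕ.<⇒≢ (Fin.toℕ<n i))
  index-injective {◁}    {at i} e = contradiction (ℕ.suc-injective (sym e)) (ℕ.<⇒≢ (Fin.toℕ<n i))

  index-surjective : ∀ m → m ℕ.≤ suc length → ∃[ l ] index {length} l ≡ m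
  index-surjective zero    _ = ▷ , refl
  index-surjective (suc m) (s≤s m≤n) with ℕ.m≤n⇒m<n∨m≡n m≤n
  ... | inj₁ m<n  = at (fromℕ< m<n) , cong suc (Fin.toℕ-fromℕ< m<n)
  ... | inj₂ refl = ◁ , refl

  ⊏-trichotomous : ∀ d l l′ → l ⊏[ d ] l′ ⊎ l ≡ l′ ⊎ l′ ⊏[ d ] l
  ⊏-trichotomous d l l′ with ℕ.<-cmp (index l) (index l′) | d
  ... | tri< p _ _ | right = inj₁ p
  ... | tri< p _ _ | left  = inj₂ (inj₂ p)
  ... | tri≈ _ p _ | _     = inj₂ (inj₁ (index-injective p))
  ... | tri> _ _ p | right = inj₂ (inj₂ p)
  ... | tri> _ _ p | left  = inj₁ p

  ⊏⇔Before : ∀ d {i j} → at i ⊏[ d ] at j ⇔ Before d i j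
  ⊏⇔Before right = mk⇔ ℕ.s≤s⁻¹ s≤s
  ⊏⇔Before left  = mk⇔ ℕ.s≤s⁻¹ s≤s

  ⊑-refl : ∀ d {l} → l ⊑[ d ] l
  ⊑-refl right = ℕ.≤-refl
  ⊑-refl left  = ℕ.≤-refl

  ⊑-trans : ∀ d {l l′ l″} → l ⊑[ d ] l′ → l′ ⊑[ d ] l″ → l ⊑[ d ] l″
  ⊑-trans right p q = ℕ.≤-trans p q
  ⊑-trans left  p q = ℕ.≤-trans q p

  ⊏⇒⊑ : ∀ d {l l′} → l ⊏[ d ] l′ → l ⊑[ d ] l′
  ⊏⇒⊑ right = ℕ.<⇒≤
  ⊏⇒⊑ left  = ℕ.<⇒≤

  ⊏⇒⋢ : ∀ d {l l′} → l ⊏[ d ] l′ → ¬ l′ ⊑[ d ] l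
  ⊏⇒⋢ right = ℕ.<⇒≱
  ⊏⇒⋢ left  = ℕ.<⇒≱

  Next-⊏ : ∀ d {l l′} → Next d l l′ → l ⊏[ d ] l′
  Next-⊏ right e = ℕ.≤-reflexive (sym e)
  Next-⊏ left  e = ℕ.≤-reflexive (sym e)

  -- One move turns the strict bound in `Exit` into the weak bound in `Region` at the new position.
  Next-⊏⇔⊑ : ∀ d {l l′ l″} → Next d l l′ → l ⊏[ d ] l″ ⇔ l′ ⊑[ d ] l″
  Next-⊏⇔⊑ right e = mk⇔ (subst (ℕ._≤ _) (sym e)) (subst (ℕ._≤ _) e)
  Next-⊏⇔⊑ left  e = mk⇔ (λ p → ℕ.s≤s⁻¹ (subst (_ ℕ.<_) e p)) (λ p → subst (_ ℕ.<_) (sym e) (s≤s p))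

  Next-NotStart : ∀ d {l l′} → Next d l l′ → NotStart d l′
  Next-NotStart right () refl
  Next-NotStart left {l} e refl = ℕ.<⇒≱ (ℕ.≤-reflexive (sym e)) (index-bounded l)

  NotStart-⊑ : ∀ d {l l′} → NotStart d l → l ⊑[ d ] l′ → NotStart d l′
  NotStart-⊑ right ns p refl = ns (index-injective (ℕ.n≤0⇒n≡0 p))
  NotStart-⊑ left {l} ns p refl = ns (index-injective (ℕ.≤-antisym (index-bounded l) p))

  -- A sweep begins on the first letter or just after a move in its direction, so it never stands on
  -- the end-marker behind it; the one in front has nothing beyond it.
  interior : ∀ d {l l′} → NotStart d l → l ⊏[ d ] l′ → ∃[ i ] l ≡ at i
  interior right {▷}    ns p = contradiction refl ns
  interior right {at i} ns p = i , refl
  interior right {◁} {l′} ns p = contradiction (index-bounded l′) (ℕ.<⇒≱ p)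
  interior left  {▷}    ns ()
  interior left  {at i} ns p = i , refl
  interior left  {◁}    ns p = contradiction refl ns

  ⊑⇒Gap : ∀ d {l l′} → l ⊑[ d ] l′ → ∃[ g ] Gap d g l l′
  ⊑⇒Gap right p = _ , ℕ.m∸n+n≡m p
  ⊑⇒Gap left  p = _ , ℕ.m∸n+n≡m p

  Gap-zero : ∀ d {l l′} → Gap d 0 l l′ → l ≡ l′
  Gap-zero right e = index-injective e
  Gap-zero left  e = index-injective (sym e)

  Gap-⊏ : ∀ d {g l l′} → Gap d (suc g) l l′ → l ⊏[ d ] l′
  Gap-⊏ right {g} e = subst (_ ℕ.<_) e (s≤s (ℕ.m≤n+m _ g))
  Gap-⊏ left  {g} e = subst (_ ℕ.<_) e (s≤s (ℕ.m≤n+m _ g))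

  Gap-suc : ∀ d {g l l′} → Gap d (suc g) l l′ → ∃[ l″ ] (Next d l l″ × Gap d g l″ l′)
  Gap-suc right {g} {l} {l′} e
    with index-surjective (suc (index l)) (ℕ.≤-trans (Gap-⊏ right {g} {l} {l′} e) (index-bounded l′))
  ... | l″ , e″ = l″ , e″ , trans (cong (g ℕ.+_) e″) (trans (ℕ.+-suc g _) e)
  Gap-suc left {g} {l} {l′} e
    with index-surjective (g ℕ.+ index l′)
           (ℕ.≤-trans (ℕ.n≤1+n _) (subst (ℕ._≤ _) (sym e) (index-bounded l)))
  ... | l″ , e″ = l″ , trans (sym e) (cong suc (sym e″)) , sym e″

  -- Formulas are evaluated at letters only, so the adjacent letter stands in for an end-marker.
  anchor : Position length → Fin length
  anchor ▷      = zero
  anchor (at i) = i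
  anchor ◁      = fromℕ length-1

  timeAt-anchor : ∀ l → timeAt ℝ ρ l ≈ time (anchor l)
  timeAt-anchor ▷      = ≈-sym time-first
  timeAt-anchor (at i) = ≈-refl
  timeAt-anchor ◁      = ≈-refl

  Region : Direction → MITL k → Position length → Set
  Region d φ l = ∀ j → j ⊨ φ ⇔ l ⊑[ d ] at j

  -- nothing means that the head cannot be moved in direction d.
  Exit : Direction → Maybe (MITL k) → Position length → Set
  Exit d nothing  l = ∀ l′ → ¬ Next d l l′
  Exit d (just φ) l = (∃[ l′ ] Next d l l′) × (∀ j → j ⊨ φ ⇔ l ⊏[ d ] at j)

-- The formula of an automaton.

module Translation (ℝ : Reals) {k} (a₀ : Fin k) (A : Po2DTA ℝ k) where
  open Po2DTA A
  open Syntax a₀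

  Q : Direction → Subset states
  Q right = Q-L
  Q left  = Q-R

  record Edge (q : State) : Set where
    constructor edge
    field
      {symbol} : Symbol k
      {guard}  : Guard clocks
      {target} : State
      {resets} : Subset clocks
      valid    : δ q symbol guard ≡ just (target , resets)

  open Edge

  toEdge′ : ∀ {q} a g m → δ q a g ≡ m → Maybe (Edge q)
  toEdge′ a g (just _) e = just (edge e)
  toEdge′ a g nothing  e = nothing

  toEdge : ∀ q → State × Symbol k × Guard clocks → Maybe (Edge q)
  toEdge q (_ , a , g) = toEdge′ a g (δ q a g) refl

  edges : ∀ q → List (Edge q)
  edges q = mapMaybe (toEdge q) domain

  -- The list of edges must contain `e` with its own validity proof; uniqueness of identity proofs
  -- identifies it with the proof found by evaluating `δ`.
  toEdge-complete : ∀ {q} (e : Edge q) m (δ≡m : δ q (symbol e) (guard e) ≡ m) →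
                    toEdge′ (symbol e) (guard e) m δ≡m ≡ just e
  toEdge-complete (edge v) m δ≡m with refl ← trans (sym δ≡m) v = cong (just ∘ edge) (uip δ≡m v)

  edges-complete : ∀ {q} (e : Edge q) → e List.∈ edges q
  edges-complete {q} e = ∈-mapMaybe⁺ (toEdge q) (in-domain (valid e)) (toEdge-complete e _ refl)

  data Mode (q : State) : Set where
    accepting : q ≡ t → Mode q
    rejecting : q ≡ r → Mode q
    sweeping  : ∀ d → q ∈ Q d → Mode q

  mode : ∀ q → Mode q
  mode q with q Fin.≟ t | q Fin.≟ r
  ... | yes q≡t | _       = accepting q≡t
  ... | no _    | yes q≡r = rejecting q≡r
  ... | no q≢t  | no q≢r  with from (covering q) [ q≢t , q≢r ]′
  ...   | inj₁ q∈L = sweeping right q∈L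
  ...   | inj₂ q∈R = sweeping left q∈R

  _⊏ˢ_ : State → State → Set
  _⊏ˢ_ = ToStrict._<_ _≡_ _≤_

  module _ (ψ : Clocks clocks) where

    enabledBy : ∀ {q} → Edge q → MITL k
    enabledBy (edge {sig a} {g} _) = atom a ∧ᶠ guardᶠ ψ g
    enabledBy (edge {▷} _)         = ⊥ᶠ
    enabledBy (edge {◁} _)         = ⊥ᶠ

    enabled : State → MITL k
    enabled q = ⋁ (map enabledBy (edges q))

    -- Marks the position at which edge e is taken by a sweep in direction d over the
    -- positions satisfying φ: the first one that enables an edge out of q. An edge
    -- taken at an end-marker is attributed to the adjacent letter position, which
    -- carries the same time stamp.
    fires : Direction → MITL k → ∀ {q} → Edge q → MITL k
    fires d φ {q} (edge {sig a} {g} _) =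
      (φ ∧ᶠ atom a ∧ᶠ guardᶠ ψ g) ∧ᶠ (¬′ earlier d (φ ∧ᶠ enabled q))
    -- The end-marker is reached exactly when no letter of the region enables an edge. The region is
    -- empty if the sweep starts on the end-marker.
    fires right φ {q} (edge {◁} {g} _) =
      (final right ∧ᶠ guardᶠ ψ g) ∧ᶠ (¬′ sometime (φ ∧ᶠ enabled q))
    fires left  φ {q} (edge {▷} {g} _) =
      (final left ∧ᶠ guardᶠ ψ g) ∧ᶠ (¬′ sometime (φ ∧ᶠ enabled q))
    fires right φ (edge {▷} _) = ⊥ᶠ
    fires left  φ (edge {◁} _) = ⊥ᶠ

  update : Clocks clocks → Subset clocks → MITL k → Clocks clocks
  update ψ X θ x = if lookup X x then θ else ψ x

  -- The positions ahead of the head when it leaves, in each direction, the place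
  -- marked by θ.
  exits : Symbol k → MITL k → Direction → Maybe (MITL k)
  exits (sig _) θ d     = just (earlier d θ)
  exits ▷       θ right = just ⊤ᶠ
  exits ▷       θ left  = nothing
  exits ◁       θ right = nothing
  exits ◁       θ left  = just ⊤ᶠ

  mutual
    sweepᶠ : ∀ q → Acc _⊏ˢ_ q → Clocks clocks → Direction → MITL k → MITL k
    sweepᶠ q (acc rs) ψ d φ = ⋁ (map (takeᶠ q rs ψ d φ) (edges q))

    -- `θ` marks a position only if the edge fires, so the formula for the target is guarded by
    -- `sometime θ`.
    takeᶠ : ∀ q → (∀ {p} → p ⊏ˢ q → Acc _⊏ˢ_ p) → Clocks clocks → Direction → MITL k → Edge q → MITL k
    takeᶠ q rs ψ d φ e =
      sometime θ ∧ᶠ enterᶠ (target e) (rs (progress (valid e))) (update ψ (resets e) θ) (exits (symbol e) θ)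
      where θ = fires ψ d φ e

    -- Regions for both directions are passed in, because the entered state decides which way the
    -- head leaves. If it cannot leave, the run is stuck and does not accept.
    enterᶠ : ∀ q → Acc _⊏ˢ_ q → Clocks clocks → (Direction → Maybe (MITL k)) → MITL k
    enterᶠ q wf ψ φ with mode q
    ... | accepting _  = ⊤ᶠ
    ... | rejecting _  = ⊥ᶠ
    ... | sweeping d _ = maybe′ (sweepᶠ q wf ψ d) ⊥ᶠ (φ d)

  states-wellFounded : ∀ q → Acc _⊏ˢ_ q
  states-wellFounded = po-wellFounded isPartialOrder

  -- All clocks start at 0, the time stamp of the first letter.
  initialClocks : Clocks clocks
  initialClocks _ = final left

  -- The head starts on the first letter, so a state entered from the right still
  -- reads that letter before the left end-marker.
  initialExits : Direction → Maybe (MITL k)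
  initialExits right = just ⊤ᶠ
  initialExits left  = just (final left)

  languageᶠ : MITL k
  languageᶠ = enterᶠ s (states-wellFounded s) initialClocks initialExits

-- Where an edge fires.

module Correctness (ℝ : Reals) {k} (a₀ : Fin k) (A : Po2DTA ℝ k) (ρ : TimedWord ℝ k) where
  open OrderedField ℝ
  open Syntax a₀
  open Semantics ℝ a₀ ρ
  open TimedWord ρ
  open Po2DTA A
  open Translation ℝ a₀ A
  open Edge
  open Run ℝ A ρ

  -- `Departs` is acceptance halfway through a step: state and clocks are already updated, the head
  -- has yet to move.
  Accepts Departs : State → Valuation ℝ clocks → Position length → Set
  Accepts q ν l = ∃[ ν′ ] ∃[ l′ ] Star _⟶_ (q , ν , l) (t , ν′ , l′)
  Departs q ν l = ∃[ l′ ] (Move q l l′ × Accepts q ν l′)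

  Enabled : State → Valuation ℝ clocks → Fin length → Set
  Enabled q ν i = Σ[ e ∈ Edge q ] (symbol e ≡ sig (letter i) × Holds ℝ ν (time i) (guard e))

  record FirstAt (d : Direction) (ν : Valuation ℝ clocks) (l₀ : Position length)
                 {q : State} (e : Edge q) (l : Position length) : Set where
    constructor firstAt
    field
      same-symbol : symbol e ≡ symbolAt ℝ ρ l
      holds       : Holds ℝ ν (timeAt ℝ ρ l) (guard e)
      ahead       : l₀ ⊑[ d ] l
      first       : ∀ i → l₀ ⊑[ d ] at i → at i ⊏[ d ] l → ¬ Enabled q ν i

  open FirstAt

  -- Of two different such positions the earlier is a letter that enables `e`, against the firstness
  -- of the later.
  FirstAt-unique : ∀ {d ν l₀ q} {e : Edge q} {l l′} → NotStart d l₀ →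
                   FirstAt d ν l₀ e l → FirstAt d ν l₀ e l′ → l ≡ l′
  FirstAt-unique {d} {ν} {l₀} {e = e} ns fa fa′ = go (⊏-trichotomous d _ _)
    where
    earlier-impossible : ∀ {l l′} → FirstAt d ν l₀ e l → FirstAt d ν l₀ e l′ → ¬ l ⊏[ d ] l′
    earlier-impossible fa fa′ l⊏l′ with interior d (NotStart-⊑ d ns (ahead fa)) l⊏l′
    ... | i , refl = first fa′ i (ahead fa) l⊏l′ (e , same-symbol fa , holds fa)
    go : _ ⊎ _ ⊎ _ → _
    go (inj₁ l⊏l′)        = contradiction l⊏l′ (earlier-impossible fa fa′)
    go (inj₂ (inj₁ l≡l′)) = l≡l′
    go (inj₂ (inj₂ l′⊏l)) = contradiction l′⊏l (earlier-impossible fa′ fa)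

  module _ {ψ : Clocks clocks} {ν : Valuation ℝ clocks} (rep : Represents ψ ν) where

    enabledBy-correct : ∀ {q} (e : Edge q) {i} →
      i ⊨ enabledBy ψ e ⇔ (symbol e ≡ sig (letter i) × Holds ℝ ν (time i) (guard e))
    enabledBy-correct (edge {sig a} {g} v) {i} = mk⇔
      (λ p → let q , h = to (⊨-∧ {i} {atom a} {guardᶠ ψ g}) p
             in cong sig (sym q) , to (guard-correct rep g) h)
      (λ { (refl , h) → from (⊨-∧ {i} {atom a} {guardᶠ ψ g}) (refl , from (guard-correct rep g) h) })
    enabledBy-correct (edge {▷} v) {i} = mk⇔ (⊥-elim ∘ ⊭-⊥ {i}) (λ ())
    enabledBy-correct (edge {◁} v) {i} = mk⇔ (⊥-elim ∘ ⊭-⊥ {i}) (λ ())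

    enabled-correct : ∀ {q i} → i ⊨ enabled ψ q ⇔ Enabled q ν i
    enabled-correct {q} = mk⇔
      (λ p → let e , h = ⊨-⋁⁻ (edges q) p in e , to (enabledBy-correct e) h)
      (λ (e , h) → ⊨-⋁⁺ (edges-complete e) (from (enabledBy-correct e) h))

    module _ {d : Direction} {φ : MITL k} {l₀ : Position length} (region : Region d φ l₀) (ns : NotStart d l₀) where

      blocking : ∀ {q i} → i ⊨ φ ∧ᶠ enabled ψ q ⇔ (l₀ ⊑[ d ] at i × Enabled q ν i)
      blocking {q} {i} = mk⇔
        (λ p → let a , b = to (⊨-∧ {i} {φ} {enabled ψ q}) p in to (region i) a , to enabled-correct b)
        (λ (a , b) → from (⊨-∧ {i} {φ} {enabled ψ q}) (from (region i) a , from enabled-correct b))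

      -- Serves ◁ for sweeps to the right and ▷ for sweeps to the left. The symbol of the edge
      -- determines the position, and every letter precedes it in the sweep.
      fires-at-end : ∀ {q} (e : Edge q) l → symbol e ≡ symbolAt ℝ ρ l → anchor l ≡ endpoint d →
        (∀ l′ → symbol e ≡ symbolAt ℝ ρ l′ → l′ ≡ l) → l₀ ⊑[ d ] l → (∀ i → at i ⊏[ d ] l) →
        ∀ {j} → j ⊨ (final d ∧ᶠ guardᶠ ψ (guard e)) ∧ᶠ (¬′ sometime (φ ∧ᶠ enabled ψ q)) ⇔
        (∃[ l ] (anchor l ≡ j × FirstAt d ν l₀ e l))
      fires-at-end {q} e l same end only l₀⊑l beyond {j} = mk⇔ f g
        where
        χ = φ ∧ᶠ enabled ψ q
        outer = ⊨-∧ {j} {final d ∧ᶠ guardᶠ ψ (guard e)} {¬′ sometime χ}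
        inner = ⊨-∧ {j} {final d} {guardᶠ ψ (guard e)}
        f : _ → ∃[ l ] (anchor l ≡ j × FirstAt d ν l₀ e l)
        f p with to outer p
        ... | p₁ , p₂ with to inner p₁
        ... | p₃ , p₄ with trans end (sym (to (final-marks d j) p₃))
        ... | refl = l , refl , firstAt same
          (Holds-resp-≈ (guard e) (≈-sym (timeAt-anchor l)) (to (guard-correct rep (guard e)) p₄))
          l₀⊑l
          (λ i l₀⊑i _ en → p₂ (from (⊨-sometime {χ}) (i , from blocking (l₀⊑i , en))))
        g : ∃[ l ] (anchor l ≡ j × FirstAt d ν l₀ e l) → _
        g (l′ , refl , fa) with only l′ (same-symbol fa)
        ... | refl = from outer
          ( from inner
              ( from (final-marks d _) end
              , from (guard-correct rep (guard e)) (Holds-resp-≈ (guard e) (timeAt-anchor l) (holds fa)))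
          , λ p → let i , b = to (⊨-sometime {χ}) p
                      l₀⊑i , en = to blocking b
                  in first fa i l₀⊑i (beyond i) en)

      fires-at-letter : ∀ {q a g p X} (v : δ q (sig a) g ≡ just (p , X)) → let e = edge v in
        ∀ {j} → j ⊨ fires ψ d φ e ⇔ (∃[ l ] (anchor l ≡ j × FirstAt d ν l₀ e l))
      fires-at-letter {q} {a} {g} v {j} = mk⇔ f h
        where
        χ = φ ∧ᶠ enabled ψ q
        e = edge v
        outer  = ⊨-∧ {j} {φ ∧ᶠ atom a ∧ᶠ guardᶠ ψ g} {¬′ earlier d χ}
        middle = ⊨-∧ {j} {φ} {atom a ∧ᶠ guardᶠ ψ g}
        inner  = ⊨-∧ {j} {atom a} {guardᶠ ψ g}
        f : _ → ∃[ l ] (anchor l ≡ j × FirstAt d ν l₀ e l)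
        f p with to outer p
        ... | p₁ , p₂ with to middle p₁
        ... | p₃ , p₄ with to inner p₄
        ... | refl , p₅ = at j , refl , firstAt refl (to (guard-correct rep g) p₅) (to (region j) p₃)
          (λ i l₀⊑i i⊏j en → p₂ (from (⊨-earlier d {χ})
            (i , to (⊏⇔Before d) i⊏j , from blocking (l₀⊑i , en))))
        h : ∃[ l ] (anchor l ≡ j × FirstAt d ν l₀ e l) → _
        h (at i , refl , firstAt refl holds l₀⊑i first) = from outer
          ( from middle (from (region i) l₀⊑i , from inner (refl , from (guard-correct rep g) holds))
          , λ p → let i′ , i′<i , b = to (⊨-earlier d {χ}) p
                      l₀⊑i′ , en = to blocking b
                  in first i′ l₀⊑i′ (from (⊏⇔Before d) i′<i) en)

    fires-correct : ∀ {d φ l₀} → Region d φ l₀ → NotStart d l₀ → ∀ {q} (e : Edge q) {j} →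
      j ⊨ fires ψ d φ e ⇔ (∃[ l ] (anchor l ≡ j × FirstAt d ν l₀ e l))
    fires-correct region ns (edge {sig a} v) = fires-at-letter region ns v
    fires-correct {right} {l₀ = l₀} region ns (edge {◁} v) =
      fires-at-end region ns (edge v) ◁ refl refl (λ { ◁ _ → refl })
        (index-bounded l₀) (λ i → s≤s (Fin.toℕ<n i))
    fires-correct {left} region ns (edge {▷} v) =
      fires-at-end region ns (edge v) ▷ refl refl (λ { ▷ _ → refl }) z≤n (λ _ → s≤s z≤n)
    fires-correct {right} region ns (edge {▷} v) {j} = mk⇔
      (⊥-elim ∘ ⊭-⊥ {j})
      (λ { (▷ , _ , fa) → contradiction refl (NotStart-⊑ right ns (ahead fa)) })
    fires-correct {left} region ns (edge {◁} v) {j} = mk⇔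
      (⊥-elim ∘ ⊭-⊥ {j})
      (λ { (◁ , _ , fa) → contradiction refl (NotStart-⊑ left ns (ahead fa)) })

    -- `anchor` is not injective, so uniqueness comes from `FirstAt-unique`, at the level of head
    -- positions.
    fires-marks : ∀ {d φ l₀} → Region d φ l₀ → NotStart d l₀ → ∀ {q} {e : Edge q} {l} →
      FirstAt d ν l₀ e l → Marks (fires ψ d φ e) (anchor l)
    fires-marks {d} {φ} {l₀} region ns {e = e} {l} fa j = mk⇔ f g
      where
      f : j ⊨ fires ψ d φ e → j ≡ anchor l
      f p with to (fires-correct region ns e) p
      ... | l′ , refl , fa′ = cong anchor (FirstAt-unique ns fa′ fa)
      g : j ≡ anchor l → j ⊨ fires ψ d φ e
      g refl = from (fires-correct region ns e) (l , refl , fa)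

    update-correct : ∀ {θ l} X → Marks θ (anchor l) →
                     Represents (update ψ X θ) (reset ℝ ν X (timeAt ℝ ρ l))
    update-correct {l = l} X marks x with lookup X x
    ... | true  = anchor l , timeAt-anchor l , marks
    ... | false = rep x

  exits-correct : ∀ {θ} l → Marks θ (anchor l) → ∀ d → Exit d (exits (symbolAt ℝ ρ l) θ d) l
  exits-correct {θ} (at i) marks d = next d , λ j → mk⇔ f g
    where
    next : ∀ d → ∃[ l ] Next d (at i) l
    next right = index-surjective (suc (suc (toℕ i))) (s≤s (Fin.toℕ<n i))
    next left  = let l , e = index-surjective (toℕ i) (ℕ.<⇒≤ (ℕ.m<n⇒m<1+n (Fin.toℕ<n i)))
                 in l , cong suc (sym e)
    f : ∀ {j} → j ⊨ earlier d θ → at i ⊏[ d ] at j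
    f p with to (⊨-earlier d {θ}) p
    ... | i′ , b , q with to (marks i′) q
    ... | refl = from (⊏⇔Before d) b
    g : ∀ {j} → at i ⊏[ d ] at j → j ⊨ earlier d θ
    g p = from (⊨-earlier d {θ}) (i , to (⊏⇔Before d) p , from (marks i) refl)
  exits-correct ▷ marks right = (at zero , refl) , λ j → mk⇔ (λ _ → s≤s z≤n) (λ _ → ⊨-⊤)
  exits-correct ▷ marks left  = λ _ ()
  exits-correct ◁ marks right = λ l′ e → ℕ.<⇒≱ (ℕ.≤-reflexive (sym e)) (index-bounded l′)
  exits-correct ◁ marks left  =
    (at (fromℕ length-1) , cong (suc ∘ suc) (sym (Fin.toℕ-fromℕ length-1))) ,
    λ j → mk⇔ (λ _ → s≤s (Fin.toℕ<n j)) (λ _ → ⊨-⊤)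

  -- Runs during one sweep.

  sweeping-active : ∀ d {q} → q ∈ Q d → ¬ Halted q
  sweeping-active right q∈ = to (covering _) (inj₁ q∈)
  sweeping-active left  q∈ = to (covering _) (inj₂ q∈)

  Next⇒Move : ∀ d {q l l′} → q ∈ Q d → Next d l l′ → Move q l l′
  Next⇒Move right = rightward
  Next⇒Move left  = leftward

  Move⇒Next : ∀ d {q l l′} → q ∈ Q d → Move q l l′ → Next d l l′
  Move⇒Next right q∈ (rightward _ e)  = e
  Move⇒Next left  q∈ (leftward _ e)   = e
  Move⇒Next right q∈ (leftward q∈′ _) = contradiction (q∈ , q∈′) (disjoint _)
  Move⇒Next left  q∈ (rightward q∈′ _) = contradiction (q∈′ , q∈) (disjoint _)
  Move⇒Next d     q∈ (remain h _)     = contradiction h (sweeping-active d q∈)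

  halted-stuck : ∀ {q ν l} → Halted q → Accepts q ν l → q ≡ t
  halted-stuck h (_ , _ , ε)                     = refl
  halted-stuck h (_ , _ , transition ¬h _ _ _ ◅ _) = contradiction h ¬h
  halted-stuck h (_ , _ , stay ¬h _ _ ◅ _)       = contradiction h ¬h

  -- Induction on the number of moves left. Each position passed is a letter by `interior`, so
  -- `idle` applies to it.
  sweep-reaches : ∀ d {q ν} → q ∈ Q d → ∀ g {l l′} → Gap d g l l′ → NotStart d l →
    (∀ i → l ⊑[ d ] at i → at i ⊏[ d ] l′ → ¬ Enabled q ν i) →
    Star _⟶_ (q , ν , l) (q , ν , l′)
  sweep-reaches d q∈ zero gap ns idle with Gap-zero d gap
  ... | refl = ε
  sweep-reaches d q∈ (suc g) {l} {l′} gap ns idle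
    with interior d {l} {l′} ns (Gap-⊏ d {g} gap) | Gap-suc d {g} {l} {l′} gap
  ... | i , refl | l″ , next , gap″ =
    stay (sweeping-active d q∈)
      (λ v h → idle i (⊑-refl d {at i}) (Gap-⊏ d {g} gap) (edge v , refl , h))
      (Next⇒Move d q∈ next)
    ◅ sweep-reaches d q∈ g gap″ (Next-NotStart d next)
        (λ i p → idle i (⊏⇒⊑ d {at _} {at i} (from (Next-⊏⇔⊑ d next) p)))

  sweep-sound : ∀ d {q ν l₀} → q ∈ Q d → NotStart d l₀ → ∀ {e : Edge q} {l} →
    FirstAt d ν l₀ e l → Departs (target e) (reset ℝ ν (resets e) (timeAt ℝ ρ l)) l →
    Accepts q ν l₀
  sweep-sound d {q} q∈ ns {e} fa (l′ , move , ν′ , l″ , run) =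
    let g , gap = ⊑⇒Gap d (ahead fa) in
    ν′ , l″ ,
    sweep-reaches d q∈ g gap ns (first fa) ◅◅
    transition (sweeping-active d q∈)
      (subst (λ a → δ q a (guard e) ≡ just (target e , resets e)) (same-symbol fa) (valid e))
      (holds fa) move ◅ run

  -- Induction on the run, with `l` the current head and `idle` recording that nothing was enabled
  -- since `l₀`. The first `transition` supplies the edge.
  sweep-complete : ∀ d {q ν l₀} → q ∈ Q d → ∀ {l} → l₀ ⊑[ d ] l →
    (∀ i → l₀ ⊑[ d ] at i → at i ⊏[ d ] l → ¬ Enabled q ν i) → Accepts q ν l →
    Σ[ e ∈ Edge q ] ∃[ l ] (FirstAt d ν l₀ e l × Departs (target e) (reset ℝ ν (resets e) (timeAt ℝ ρ l)) l)
  sweep-complete d q∈ l₀⊑l idle (_ , _ , ε) = contradiction (inj₁ refl) (sweeping-active d q∈)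
  sweep-complete d q∈ {l} l₀⊑l idle (ν′ , l″ , transition {l′ = l′} _ v h move ◅ run) =
    edge v , l , firstAt refl h l₀⊑l idle , l′ , move , ν′ , l″ , run
  sweep-complete d {q} {ν} {l₀} q∈ {l} l₀⊑l idle (ν′ , l″ , stay {l′ = l′} _ disabled move ◅ run) =
    sweep-complete d q∈ (⊑-trans d {l₀} {l} {l′} l₀⊑l (⊏⇒⊑ d {l} {l′} (Next-⊏ d next))) idle′ (ν′ , l″ , run)
    where
    next = Move⇒Next d q∈ move
    idle′ : ∀ i → l₀ ⊑[ d ] at i → at i ⊏[ d ] l′ → ¬ Enabled q ν i
    -- The only letter newly passed is the one at `l`, which the `stay` step excludes.
    idle′ i p i⊏l′ (e , same , h) with ⊏-trichotomous d (at i) l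
    ... | inj₁ i⊏l = idle i p i⊏l (e , same , h)
    ... | inj₂ (inj₁ refl) = disabled (subst (λ a → δ q a (guard e) ≡ _) same (valid e)) h
    ... | inj₂ (inj₂ l⊏i) = ⊏⇒⋢ d {at i} {l′} i⊏l′ (to (Next-⊏⇔⊑ d next) l⊏i)

  -- Correctness by induction on states.

  mutual
    -- The position `i` is arbitrary: `sometime` makes the formula insensitive to where it is
    -- evaluated, so the formula for the target can be read at the same place.
    sweep-correct : ∀ q wf {ψ ν d φ l i} → q ∈ Q d → Represents ψ ν → Region d φ l → NotStart d l →
                    i ⊨ sweepᶠ q wf ψ d φ ⇔ Accepts q ν l
    sweep-correct q (acc rs) {ψ} {ν} {d} {φ} {l} {i} q∈ rep region ns = mk⇔ f g
      where
      module _ (e : Edge q) where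
        θ = fires ψ d φ e
        φ′ = exits (symbol e) θ
        continuation = enterᶠ (target e) (rs (progress (valid e))) (update ψ (resets e) θ) φ′
        continue : ∀ {l′} → FirstAt d ν l e l′ →
          i ⊨ continuation ⇔ Departs (target e) (reset ℝ ν (resets e) (timeAt ℝ ρ l′)) l′
        continue {l′} fa = enter-correct (target e) (rs (progress (valid e)))
          (update-correct rep {l = l′} (resets e) marks)
          -- The formula picks its exits by the symbol of the edge, which agrees with the symbol
          -- under the head because the edge fires there.
          (λ d → subst (λ a → Exit d (exits a θ d) l′) (sym (same-symbol fa)) (exits-correct l′ marks d))
          where marks = fires-marks rep region ns fa
        split = ⊨-∧ {i} {sometime θ} {continuation}

      f : i ⊨ sweepᶠ q (acc rs) ψ d φ → Accepts q ν l
      f p with ⊨-⋁⁻ (edges q) p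
      ... | e , p₁ with to (split e) p₁
      ... | p₂ , p₃ with to (⊨-sometime {θ e}) p₂
      ... | j , p₄ with to (fires-correct rep region ns e) p₄
      ... | l′ , _ , fa = sweep-sound d q∈ ns fa (to (continue e fa) p₃)

      g : Accepts q ν l → i ⊨ sweepᶠ q (acc rs) ψ d φ
      g run with sweep-complete d q∈ (⊑-refl d {l}) (λ j p p′ → contradiction p (⊏⇒⋢ d {at j} {l} p′)) run
      ... | e , l′ , fa , dep = ⊨-⋁⁺ (edges-complete e)
        (from (split e)
          ( from (⊨-sometime {θ e}) (anchor l′ , from (fires-correct rep region ns e) (l′ , refl , fa))
          , from (continue e fa) dep))

    enter-correct : ∀ q wf {ψ ν φ l i} → Represents ψ ν → (∀ d → Exit d (φ d) l) →
                    i ⊨ enterᶠ q wf ψ φ ⇔ Departs q ν l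
    enter-correct q wf {φ = φ} {l} {i} rep exit with mode q
    ... | accepting refl = mk⇔ (λ _ → l , remain (inj₁ refl) refl , _ , _ , ε) (λ _ → ⊨-⊤)
    ... | rejecting refl = mk⇔ (⊥-elim ∘ ⊭-⊥ {i})
      (λ (_ , _ , run) → contradiction (sym (halted-stuck (inj₂ refl) run)) t≢r)
    ... | sweeping d q∈ with φ d | exit d
    ...   | nothing | stuck = mk⇔ (⊥-elim ∘ ⊭-⊥ {i})
      (λ (l′ , move , _) → contradiction (Move⇒Next d q∈ move) (stuck l′))
    ...   | just ψ′ | (l′ , next) , region = mk⇔
      (λ p → l′ , Next⇒Move d q∈ next , to (sweep next) p)
      (λ (l″ , move , run) → from (sweep (Move⇒Next d q∈ move)) run)
      where
      -- Stated for any next position, since a given run brings its own instead of `l′`.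
      sweep : ∀ {l″} → Next d l l″ → _ ⇔ Accepts q _ l″
      sweep next = sweep-correct q wf q∈ rep
        (λ j → mk⇔ (to (Next-⊏⇔⊑ d next) ∘ to (region j)) (from (region j) ∘ from (Next-⊏⇔⊑ d next)))
        (Next-NotStart d next)

  -- `initialExits` describes regions that include the first letter, where the head already stands,
  -- so `sweep-correct` is applied with no preceding move.
  language-correct : ∀ {i} → i ⊨ languageᶠ ⇔ Language-Po2DTA ℝ A ρ
  language-correct {i} with mode s
  ... | accepting s≡t = mk⇔ (λ _ → _ , _ , subst (λ q → Star _⟶_ _ (q , _ , _)) s≡t ε) (λ _ → ⊨-⊤)
  ... | rejecting s≡r = mk⇔ (⊥-elim ∘ ⊭-⊥ {i})
      (λ run → contradiction (trans (sym (halted-stuck (inj₂ s≡r) run)) s≡r) t≢r)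
  ... | sweeping right s∈ = sweep-correct s (states-wellFounded s) s∈
      (λ _ → zero , ≈-sym time-first , final-marks left)
      (λ j → mk⇔ (λ _ → s≤s z≤n) (λ _ → ⊨-⊤)) (λ ())
  ... | sweeping left s∈ = sweep-correct s (states-wellFounded s) s∈
      (λ _ → zero , ≈-sym time-first , final-marks left)
      (λ j → mk⇔ (λ p → ℕ.≤-reflexive (cong (index ∘ at) (to (final-marks left j) p)))
                 (λ p → from (final-marks left j)
                          (Fin.toℕ-injective (ℕ.n≤0⇒n≡0 (ℕ.s≤s⁻¹ p)))))
      (λ ())

theorem2 : (ℝ : Reals) (k : ℕ) .{{_ : NonZero k}} (A : Po2DTA ℝ k) → Σ[ φ ∈ MITL k ] (Language-Po2DTA ℝ A ≐ Language-MITL ℝ φ)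
theorem2 ℝ (suc k) A =
  Translation.languageᶠ ℝ zero A ,
  (λ {ρ} → from (Correctness.language-correct ℝ zero A ρ)) ,
  (λ {ρ} → to (Correctness.language-correct ℝ zero A ρ))
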